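{- Let $n\ge2$. Let $A_1=\{2\text{ - }13,21\text{ - }3\}$, $A_2=\{2\text{ - }31,23\text{ - }1\}$, $A_3=\{1\text{ - }32,13\text{ - }2\}$, $A_4=\{3\text{ - }12,31\text{ - }2\}$. For every choice of $p_i\in A_i$ ($i=1,2,3,4$), $|S_n(p_1,p_2,p_3,p_4)|=2$ and $$S_n(p_1,p_2,p_3,p_4)=\{\,n\,(n-1)\ldots 2\,1,\ \ 1\,2\ldots n\,\}.$$
   Context: $S_n$ is the set of permutations $\pi=\pi_1\pi_2\cdots\pi_n$ of $\{1,\dots,n\}$ (written in one-line notation). For $abc$ a permutation of $123$, the generalized pattern $a\text{ - }bc$ is contained in $\pi$ if there are indices $i<j$ with $j+1\le n$ such that $\pi_i\pi_j\pi_{j+1}$ is order-isomorphic to $abc$; the generalized pattern $ab\text{ - }c$ is contained in $\pi$ if there are indices $i,k$ with $i+1<k\le n$ such that $\pi_i\pi_{i+1}\pi_k$ is order-isomorphic to $abc$. $\pi$ avoids a pattern if it does not contain it. $S_n(p_1,\dots,p_m)$ is the set of $\pi\in S_n$ avoiding all of $p_1,\dots,p_m$. -}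

module Defs where

open import Data.Fin.Base using (Fin; toℕ; _<_)
open import Data.Fin.Patterns using (0F; 1F; 2F)
open import Data.Fin.Permutation using (Permutation′; permutation; _⟨$⟩ʳ_)
open import Data.Fin.Properties using (_≟_; all?)
open import Data.List.Base using (List)
open import Data.List.Relation.Unary.All using (All)
open import Data.Nat.Base using (ℕ; suc)
open import Data.Product.Base using (Σ; proj₁; _×_; ∃-syntax)
import Data.Vec.Base as Vec
import Data.Vec.Functional as Word
open Vec using (Vec; lookup)
open import Function.Bundles using (Bijection; _⇔_)
open import Level using (0ℓ)
open import Relation.Binary.Bundles using (Setoid)
import Relation.Binary.Construct.On as On
open import Relation.Binary.PropositionalEquality using (_≡_; setoid; _→-setoid_)
open import Relation.Nullary.Decidable using (True; toWitness)
open import Relation.Nullary.Negation using (¬_)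
open import Relation.Unary using (Pred; ｛_｝; _∪_)

-- Positions and values both run over 0, …, n ∸ 1 (the elements of Fin n)
-- instead of 1, …, n: the i-th letter of π is π ⟨$⟩ʳ i.

oneLine : ∀ {n} (w w⁻¹ : Vec (Fin n) n)
          {_ : True (all? λ i → lookup w (lookup w⁻¹ i) ≟ i)}
          {_ : True (all? λ i → lookup w⁻¹ (lookup w i) ≟ i)} →
          Permutation′ n
oneLine w w⁻¹ {invˡ} {invʳ} =
  permutation (lookup w) (lookup w⁻¹) (toWitness invˡ) (toWitness invʳ)

OrderIsomorphic : ∀ {k m n} → (Fin k → Fin m) → (Fin k → Fin n) → Set
OrderIsomorphic u w = ∀ s t → (u s < u t) ⇔ (w s < w t)

data Pattern : Set where
  a-bc ab-c : (abc : Permutation′ 3) → Pattern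

Contains : ∀ {n} → Pattern → Permutation′ n → Set
Contains {n} (a-bc abc) π =
  ∃[ i ] ∃[ j ] ∃[ j⁺ ] i < j × toℕ j⁺ ≡ suc (toℕ j) ×
    OrderIsomorphic {n = n}
      (abc ⟨$⟩ʳ_)
      ((π ⟨$⟩ʳ i) Word.∷ (π ⟨$⟩ʳ j) Word.∷ (π ⟨$⟩ʳ j⁺) Word.∷ Word.[])
Contains {n} (ab-c abc) π =
  ∃[ i ] ∃[ i⁺ ] ∃[ k ] toℕ i⁺ ≡ suc (toℕ i) × i⁺ < k ×
    OrderIsomorphic {n = n}
      (abc ⟨$⟩ʳ_)
      ((π ⟨$⟩ʳ i) Word.∷ (π ⟨$⟩ʳ i⁺) Word.∷ (π ⟨$⟩ʳ k) Word.∷ Word.[])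

Avoids : ∀ {n} → Permutation′ n → Pattern → Set
Avoids π p = ¬ Contains p π

S : ∀ n → List Pattern → Pred (Permutation′ n) 0ℓ
S n ps π = All (Avoids π) ps

-- Permutations are compared pointwise (as in Data.Fin.Permutation._≈_),
-- since a Permutation′ also carries its inverse and the inverse laws.
permSetoid : ℕ → Setoid 0ℓ 0ℓ
permSetoid n = On.setoid (Fin n →-setoid Fin n) _⟨$⟩ʳ_

subSetoid : ∀ {n} → Pred (Permutation′ n) 0ℓ → Setoid 0ℓ 0ℓ
subSetoid {n} P = On.setoid {B = Σ (Permutation′ n) P} (permSetoid n) proj₁

HasCardinality : ∀ {n} → Pred (Permutation′ n) 0ℓ → ℕ → Set
HasCardinality P c = Bijection (setoid (Fin c)) (subSetoid P)

-- The digits 1, 2, 3 of a pattern name are 0F, 1F, 2F.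
[132] [213] [231] [312] : Permutation′ 3
[132] = oneLine (0F Vec.∷ 2F Vec.∷ 1F Vec.∷ Vec.[]) (0F Vec.∷ 2F Vec.∷ 1F Vec.∷ Vec.[])
[213] = oneLine (1F Vec.∷ 0F Vec.∷ 2F Vec.∷ Vec.[]) (1F Vec.∷ 0F Vec.∷ 2F Vec.∷ Vec.[])
[231] = oneLine (1F Vec.∷ 2F Vec.∷ 0F Vec.∷ Vec.[]) (2F Vec.∷ 0F Vec.∷ 1F Vec.∷ Vec.[])
[312] = oneLine (2F Vec.∷ 0F Vec.∷ 1F Vec.∷ Vec.[]) (1F Vec.∷ 2F Vec.∷ 0F Vec.∷ Vec.[])

A₁ A₂ A₃ A₄ : Pred Pattern 0ℓ
A₁ = ｛ a-bc [213] ｝ ∪ ｛ ab-c [213] ｝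
A₂ = ｛ a-bc [231] ｝ ∪ ｛ ab-c [231] ｝
A₃ = ｛ a-bc [132] ｝ ∪ ｛ ab-c [132] ｝
A₄ = ｛ a-bc [312] ｝ ∪ ｛ ab-c [312] ｝

{-# OPTIONS --safe #-}

-- A permutation in which no three consecutive letters form a peak or a valley
-- is monotone, hence the identity or the reversal. A consecutive peak is an
-- occurrence of 132 or 231, and a consecutive valley one of 213 or 312, whichever
-- of the two adjacency conditions is imposed; so avoiding one version of each of
-- the four patterns excludes all turns. Conversely each of the four patterns turns,
-- so it cannot occur in a monotone permutation, with or without adjacency.
module Submission where

open import Defs
open import Data.Fin.Base as Fin using (Fin; zero; suc; toℕ; inject₁; opposite; _<_; _>_)
open import Data.Fin.Induction using (<-weakInduction; >-weakInduction)
open import Data.Fin.Patterns using (0F; 1F; 2F)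
open import Data.Fin.Permutation using (Permutation′; _≈_; id; reverse; _⟨$⟩ʳ_)
open import Data.Fin.Properties
  using (<-cmp; <-asym; <-irrefl; <-trans; <⇒≢; ≤-antisym; ≤fromℕ; ≤̄⇒inject₁<;
         toℕ-inject₁; toℕ<n; opposite-prop; opposite-involutive)
open import Data.List.Base using ([]; _∷_)
open import Data.List.Relation.Unary.All using ([]; _∷_)
open import Data.Nat.Base as ℕ using (ℕ; zero; suc; _≤_; z≤n; s≤s; s≤s⁻¹)
import Data.Nat.Properties as ℕ
open import Data.Product.Base using (_×_; _,_; ∃-syntax; map)
open import Data.Sum.Base as Sum using (_⊎_; inj₁; inj₂; [_,_]′)
import Data.Vec.Functional as Word
open import Function.Base using (_∘_)
open import Function.Bundles using (_⇔_; mk⇔; Equivalence; Injection)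
open import Function.Definitions using (Injective; Surjective)
open import Function.Properties.Inverse using (↔⇒↣)
open import Relation.Binary.Bundles using (Setoid)
open import Relation.Binary.Definitions using (tri<; tri≈; tri>)
open import Relation.Binary.PropositionalEquality
  using (_≡_; refl; sym; trans; cong; subst; subst₂)
open import Relation.Nullary.Negation using (¬_; contradiction)
open import Relation.Unary using (Pred; _∈_; _∪_; ｛_｝)

private
  variable
    k m n : ℕ

StrictlyIncreasing StrictlyDecreasing : (Fin m → Fin n) → Set
StrictlyIncreasing f = ∀ {i j} → i < j → f i < f j
StrictlyDecreasing f = ∀ {i j} → i < j → f i > f j

-- `opposite j` is `n ∸ suc j`, and truncated subtraction is strictly antitone here because
-- `suc j ≤ n`.
opposite-strictlyDecreasing : StrictlyDecreasing (opposite {n})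
opposite-strictlyDecreasing {i = i} {j} i<j =
  subst₂ ℕ._<_ (sym (opposite-prop j)) (sym (opposite-prop i))
    (ℕ.∸-monoʳ-< (s≤s i<j) (toℕ<n j))

-- Every step gains at least one. Counting up from position `0` gives `i ≤ f i`; counting down from
-- the last position, where the value is at most the maximum, gives `f i ≤ i`.
increasingSteps⇒id : (f : Fin (suc n) → Fin (suc n)) →
                     (∀ i → f (inject₁ i) < f (suc i)) → ∀ i → f i ≡ i
increasingSteps⇒id f step i = ≤-antisym (below i) (above i)
  where
  above : ∀ i → i Fin.≤ f i
  above = <-weakInduction _ z≤n λ i i≤fi →
    ℕ.≤-<-trans (subst (ℕ._≤ toℕ (f (inject₁ i))) (toℕ-inject₁ i) i≤fi) (step i)

  below : ∀ i → f i Fin.≤ i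
  below = >-weakInduction _ (≤fromℕ _) λ i fi≤i →
    subst (toℕ (f (inject₁ i)) ℕ.≤_) (sym (toℕ-inject₁ i))
      (s≤s⁻¹ (ℕ.<-≤-trans (step i) fi≤i))

-- Composing with the involution `opposite` reduces this to the increasing case.
decreasingSteps⇒opposite : (f : Fin (suc n) → Fin (suc n)) →
                           (∀ i → f (inject₁ i) > f (suc i)) → ∀ i → f i ≡ opposite i
decreasingSteps⇒opposite f step i = trans (sym (opposite-involutive (f i)))
  (cong opposite
    (increasingSteps⇒id (opposite ∘ f) (opposite-strictlyDecreasing ∘ step) i))

Peak Valley : (x y z : Fin n) → Set
Peak   x y z = x < y × z < y
Valley x y z = y < x × y < z

adjacent-compare : (f : Fin (suc m) → Fin n) → Injective _≡_ _≡_ f →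
                   ∀ i → f (inject₁ i) < f (suc i) ⊎ f (inject₁ i) > f (suc i)
adjacent-compare f inj i with <-cmp (f (inject₁ i)) (f (suc i))
... | tri< x<y _ _ = inj₁ x<y
... | tri≈ _ x≡y _ = contradiction (inj x≡y) (<⇒≢ (≤̄⇒inject₁< ℕ.≤-refl))
... | tri> _ _ x>y = inj₂ x>y

-- The direction of the first step propagates by induction: a change of direction would create a
-- peak or a valley.
turnless⇒monotoneSteps :
  (f : Fin (suc (suc m)) → Fin n) → Injective _≡_ _≡_ f →
  (∀ i → ¬ Peak   (f (inject₁ (inject₁ i))) (f (suc (inject₁ i))) (f (suc (suc i)))) →
  (∀ i → ¬ Valley (f (inject₁ (inject₁ i))) (f (suc (inject₁ i))) (f (suc (suc i)))) →
  (∀ i → f (inject₁ i) > f (suc i)) ⊎ (∀ i → f (inject₁ i) < f (suc i))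
turnless⇒monotoneSteps f inj noPeak noValley with adjacent-compare f inj zero
... | inj₁ f0<f1 = inj₂ (<-weakInduction _ f0<f1 λ i x<y →
  [ (λ y<z → y<z) , (λ y>z → contradiction (x<y , y>z) (noPeak i)) ]′
    (adjacent-compare f inj (suc i)))
... | inj₂ f0>f1 = inj₁ (<-weakInduction _ f0>f1 λ i x>y →
  [ (λ y<z → contradiction (x>y , y<z) (noValley i)) , (λ y>z → y>z) ]′
    (adjacent-compare f inj (suc i)))

-- By trichotomy a strictly increasing `g` also reflects `<`. Taking for `g` the three letters in
-- sorted order, an occurrence is verified by three equations instead of nine comparisons.
increasing⇒orderIsomorphic : {g : Fin m → Fin n} → StrictlyIncreasing g →
  (u : Fin k → Fin m) (w : Fin k → Fin n) → (∀ s → w s ≡ g (u s)) → OrderIsomorphic u w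
increasing⇒orderIsomorphic {g = g} g↑ u w w≡g∘u s t = mk⇔
  (subst₂ _<_ (sym (w≡g∘u s)) (sym (w≡g∘u t)) ∘ g↑)
  (reflects ∘ subst₂ _<_ (w≡g∘u s) (w≡g∘u t))
  where
  reflects : ∀ {a b} → g a < g b → a < b
  reflects {a} {b} ga<gb with <-cmp a b
  ... | tri< a<b _ _ = a<b
  ... | tri≈ _ refl _ = contradiction ga<gb (<-irrefl refl)
  ... | tri> _ _ b<a = contradiction (g↑ b<a) (<-asym ga<gb)

word : Fin n → Fin n → Fin n → Fin 3 → Fin n
word x y z = x Word.∷ y Word.∷ z Word.∷ Word.[]

word-increasing : {x y z : Fin n} → x < y → y < z → StrictlyIncreasing (word x y z)
word-increasing x<y y<z {0F} {1F} _ = x<y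
word-increasing x<y y<z {0F} {2F} _ = <-trans x<y y<z
word-increasing x<y y<z {1F} {2F} _ = y<z
word-increasing x<y y<z {1F} {1F} (s≤s ())
word-increasing x<y y<z {2F} {1F} (s≤s ())
word-increasing x<y y<z {2F} {2F} (s≤s (s≤s ()))

132-occurrence : {x y z : Fin n} → x < z → z < y →
                 OrderIsomorphic ([132] ⟨$⟩ʳ_) (word x y z)
-- Here `g` is `word x z y`, whose composite with `[132]` is `word x y z`; the other three patterns
-- are sorted likewise.
132-occurrence x<z z<y = increasing⇒orderIsomorphic (word-increasing x<z z<y) _ _
  λ { 0F → refl ; 1F → refl ; 2F → refl }

231-occurrence : {x y z : Fin n} → z < x → x < y →
                 OrderIsomorphic ([231] ⟨$⟩ʳ_) (word x y z)
231-occurrence z<x x<y = increasing⇒orderIsomorphic (word-increasing z<x x<y) _ _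
  λ { 0F → refl ; 1F → refl ; 2F → refl }

213-occurrence : {x y z : Fin n} → y < x → x < z →
                 OrderIsomorphic ([213] ⟨$⟩ʳ_) (word x y z)
213-occurrence y<x x<z = increasing⇒orderIsomorphic (word-increasing y<x x<z) _ _
  λ { 0F → refl ; 1F → refl ; 2F → refl }

312-occurrence : {x y z : Fin n} → y < z → z < x →
                 OrderIsomorphic ([312] ⟨$⟩ʳ_) (word x y z)
312-occurrence y<z z<x = increasing⇒orderIsomorphic (word-increasing y<z z<x) _ _
  λ { 0F → refl ; 1F → refl ; 2F → refl }

-- Each of `A₁` to `A₄` is by definition this set at its own permutation, so lemmas about it cover
-- all four choices.
Versions : Permutation′ 3 → Pred Pattern _
Versions abc = ｛ a-bc abc ｝ ∪ ｛ ab-c abc ｝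

successor⇒< : {i j : Fin n} → toℕ j ≡ suc (toℕ i) → i < j
successor⇒< = ℕ.≤-reflexive ∘ sym

consecutive⇒contains : {abc : Permutation′ 3} {p : Pattern} → p ∈ Versions abc →
  (π : Permutation′ n) {i j k : Fin n} → toℕ j ≡ suc (toℕ i) → toℕ k ≡ suc (toℕ j) →
  OrderIsomorphic (abc ⟨$⟩ʳ_) (word (π ⟨$⟩ʳ i) (π ⟨$⟩ʳ j) (π ⟨$⟩ʳ k)) → Contains p π
consecutive⇒contains (inj₁ refl) π j≡1+i k≡1+j iso =
  _ , _ , _ , successor⇒< j≡1+i , k≡1+j , iso
consecutive⇒contains (inj₂ refl) π j≡1+i k≡1+j iso =
  _ , _ , _ , j≡1+i , successor⇒< k≡1+j , iso

-- Forgetting the adjacency condition lets both versions be refuted by one argument.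
contains⇒scattered : {abc : Permutation′ 3} {p : Pattern} → p ∈ Versions abc →
  (π : Permutation′ n) → Contains p π →
  ∃[ i ] ∃[ j ] ∃[ k ] i < j × j < k ×
    OrderIsomorphic (abc ⟨$⟩ʳ_) (word (π ⟨$⟩ʳ i) (π ⟨$⟩ʳ j) (π ⟨$⟩ʳ k))
contains⇒scattered (inj₁ refl) π (i , j , k , i<j , k≡1+j , iso) =
  i , j , k , i<j , successor⇒< k≡1+j , iso
contains⇒scattered (inj₂ refl) π (i , j , k , j≡1+i , j<k , iso) =
  i , j , k , successor⇒< j≡1+i , j<k , iso

Turns : (x y z : Fin n) → Set
Turns x y z = Peak x y z ⊎ Valley x y z

turns⇒¬monotone : {f : Fin m → Fin n} {i j k : Fin m} → i < j → j < k →
  StrictlyDecreasing f ⊎ StrictlyIncreasing f → ¬ Turns (f i) (f j) (f k)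
turns⇒¬monotone i<j j<k (inj₁ f↓) (inj₁ (x<y , _)) = <-asym x<y (f↓ i<j)
turns⇒¬monotone i<j j<k (inj₁ f↓) (inj₂ (_ , y<z)) = <-asym y<z (f↓ j<k)
turns⇒¬monotone i<j j<k (inj₂ f↑) (inj₁ (_ , z<y)) = <-asym z<y (f↑ j<k)
turns⇒¬monotone i<j j<k (inj₂ f↑) (inj₂ (y<x , _)) = <-asym y<x (f↑ i<j)

-- A turn consists of two comparisons with the middle letter, and an order isomorphism transports
-- both.
turns-orderIsomorphic : (u : Fin 3 → Fin m) {x y z : Fin n} →
  OrderIsomorphic u (word x y z) → Turns (u 0F) (u 1F) (u 2F) → Turns x y z
turns-orderIsomorphic u iso = Sum.map
  (map (to (iso 0F 1F)) (to (iso 2F 1F))) (map (to (iso 1F 0F)) (to (iso 1F 2F)))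
  where open Equivalence using (to)

monotone⇒avoids : {abc : Permutation′ 3} {p : Pattern} → p ∈ Versions abc →
  Turns (abc ⟨$⟩ʳ 0F) (abc ⟨$⟩ʳ 1F) (abc ⟨$⟩ʳ 2F) → (π : Permutation′ n) →
  StrictlyDecreasing (π ⟨$⟩ʳ_) ⊎ StrictlyIncreasing (π ⟨$⟩ʳ_) → Avoids π p
monotone⇒avoids {abc = abc} p∈ turns π mono contains =
  let i , j , k , i<j , j<k , iso = contains⇒scattered p∈ π contains
  in turns⇒¬monotone {f = π ⟨$⟩ʳ_} i<j j<k mono (turns-orderIsomorphic (abc ⟨$⟩ʳ_) iso turns)

extremes⇒monotone : (π : Permutation′ n) → π ≈ reverse ⊎ π ≈ id →
                    StrictlyDecreasing (π ⟨$⟩ʳ_) ⊎ StrictlyIncreasing (π ⟨$⟩ʳ_)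
extremes⇒monotone π = Sum.map
  (λ π≈rev {i} {j} i<j →
    subst₂ _<_ (sym (π≈rev j)) (sym (π≈rev i)) (opposite-strictlyDecreasing i<j))
  (λ π≈id {i} {j} i<j → subst₂ _<_ (sym (π≈id i)) (sym (π≈id j)) i<j)

module _ {p₁ p₂ p₃ p₄ : Pattern}
         (p₁∈A₁ : p₁ ∈ A₁) (p₂∈A₂ : p₂ ∈ A₂) (p₃∈A₃ : p₃ ∈ A₃) (p₄∈A₄ : p₄ ∈ A₄) where

  extremes⇒avoid : (π : Permutation′ n) → π ≈ reverse ⊎ π ≈ id →
                   π ∈ S n (p₁ ∷ p₂ ∷ p₃ ∷ p₄ ∷ [])
  extremes⇒avoid π extreme =
    -- `213` and `312` are valleys, `231` and `132` are peaks.
    avoids p₁∈A₁ (inj₂ (s≤s z≤n , s≤s z≤n)) ∷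
    avoids p₂∈A₂ (inj₁ (s≤s (s≤s z≤n) , s≤s z≤n)) ∷
    avoids p₃∈A₃ (inj₁ (s≤s z≤n , s≤s (s≤s z≤n))) ∷
    avoids p₄∈A₄ (inj₂ (s≤s z≤n , s≤s z≤n)) ∷ []
    where
    avoids : {abc : Permutation′ 3} {p : Pattern} → p ∈ Versions abc →
             Turns (abc ⟨$⟩ʳ 0F) (abc ⟨$⟩ʳ 1F) (abc ⟨$⟩ʳ 2F) → Avoids π p
    avoids {abc} p∈ turns = monotone⇒avoids {abc = abc} p∈ turns π (extremes⇒monotone π extreme)

  avoid⇒extremes : (π : Permutation′ (suc (suc m))) →
    π ∈ S (suc (suc m)) (p₁ ∷ p₂ ∷ p₃ ∷ p₄ ∷ []) → π ≈ reverse ⊎ π ≈ id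
  avoid⇒extremes {m} π (avoids₁ ∷ avoids₂ ∷ avoids₃ ∷ avoids₄ ∷ []) =
    Sum.map (decreasingSteps⇒opposite f) (increasingSteps⇒id f)
      (turnless⇒monotoneSteps f f-injective noPeak noValley)
    where
    f : Fin (suc (suc m)) → Fin (suc (suc m))
    f = π ⟨$⟩ʳ_

    f-injective : Injective _≡_ _≡_ f
    f-injective = Injection.injective (↔⇒↣ π)

    -- Each `i` gives one window of three consecutive positions; for `n = 2` there is none.
    module _ (i : Fin m) where
      a b c : Fin (suc (suc m))
      a = inject₁ (inject₁ i)
      b = suc (inject₁ i)
      c = suc (suc i)

      b≡1+a : toℕ b ≡ suc (toℕ a)
      b≡1+a = cong suc (sym (toℕ-inject₁ (inject₁ i)))

      c≡1+b : toℕ c ≡ suc (toℕ b)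
      c≡1+b = cong (2 ℕ.+_) (sym (toℕ-inject₁ i))

      a≢c : ¬ a ≡ c
      a≢c = <⇒≢ (<-trans (successor⇒< b≡1+a) (successor⇒< c≡1+b))

      occurs : {abc : Permutation′ 3} {p : Pattern} → p ∈ Versions abc →
               OrderIsomorphic (abc ⟨$⟩ʳ_) (word (f a) (f b) (f c)) → Contains p π
      occurs {abc} p∈ = consecutive⇒contains {abc = abc} p∈ π b≡1+a c≡1+b

      noPeak : ¬ Peak (f a) (f b) (f c)
      -- The order of the outer letters decides between `132` and `231`; equality contradicts
      -- injectivity.
      noPeak (x<y , z<y) with <-cmp (f a) (f c)
      ... | tri< x<z _ _ = avoids₃ (occurs p₃∈A₃ (132-occurrence x<z z<y))
      ... | tri≈ _ x≡z _ = a≢c (f-injective x≡z)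
      ... | tri> _ _ z<x = avoids₂ (occurs p₂∈A₂ (231-occurrence z<x x<y))

      noValley : ¬ Valley (f a) (f b) (f c)
      -- Likewise, the outer letters decide between `213` and `312`.
      noValley (y<x , y<z) with <-cmp (f a) (f c)
      ... | tri< x<z _ _ = avoids₁ (occurs p₁∈A₁ (213-occurrence y<x x<z))
      ... | tri≈ _ x≡z _ = a≢c (f-injective x≡z)
      ... | tri> _ _ z<x = avoids₄ (occurs p₄∈A₄ (312-occurrence y<z z<x))

-- Members of `P` are compared only as functions, so listing `ρ` and `σ` is injective by their
-- distinctness and surjective by exhaustiveness.
pair-cardinality : (P : Pred (Permutation′ n) _) (ρ σ : Permutation′ n) → ¬ ρ ≈ σ →
  ρ ∈ P → σ ∈ P → (∀ π → π ∈ P → π ≈ ρ ⊎ π ≈ σ) → HasCardinality P 2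
pair-cardinality P ρ σ ρ≉σ ρ∈P σ∈P exhaustive = record
  { to        = enum
  ; cong      = λ { refl _ → refl }
  ; bijective = injective , surjective
  }
  where
  open Setoid (subSetoid P) using () renaming (_≈_ to _≋_; Carrier to Member)

  enum : Fin 2 → Member
  enum 0F = ρ , ρ∈P
  enum 1F = σ , σ∈P

  injective : Injective _≡_ _≋_ enum
  injective {0F} {0F} _   = refl
  injective {0F} {1F} ρ≈σ = contradiction ρ≈σ ρ≉σ
  injective {1F} {0F} σ≈ρ = contradiction (λ i → sym (σ≈ρ i)) ρ≉σ
  injective {1F} {1F} _   = refl

  surjective : Surjective _≡_ _≋_ enum
  surjective (π , π∈P) with exhaustive π π∈P
  ... | inj₁ π≈ρ = 0F , λ { refl i → sym (π≈ρ i) }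
  ... | inj₂ π≈σ = 1F , λ { refl i → sym (π≈σ i) }

proposition2p7 : ∀ (n : ℕ) → 2 ≤ n →
    ∀ (p₁ p₂ p₃ p₄ : Pattern) → p₁ ∈ A₁ → p₂ ∈ A₂ → p₃ ∈ A₃ → p₄ ∈ A₄ →
    HasCardinality (S n (p₁ ∷ p₂ ∷ p₃ ∷ p₄ ∷ [])) 2 ×
    (∀ (π : Permutation′ n) →
    π ∈ S n (p₁ ∷ p₂ ∷ p₃ ∷ p₄ ∷ []) ⇔ (π ≈ reverse ⊎ π ≈ id))
proposition2p7 (suc (suc m)) _ p₁ p₂ p₃ p₄ p₁∈A₁ p₂∈A₂ p₃∈A₃ p₄∈A₄ =
  pair-cardinality (S _ _) reverse id reverse≉id
    (extremes _ (inj₁ λ _ → refl)) (extremes _ (inj₂ λ _ → refl)) avoiders ,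
  λ π → mk⇔ (avoiders π) (extremes π)
  where
  extremes = extremes⇒avoid p₁∈A₁ p₂∈A₂ p₃∈A₃ p₄∈A₄
  avoiders = avoid⇒extremes p₁∈A₁ p₂∈A₂ p₃∈A₃ p₄∈A₄

  reverse≉id : ¬ reverse {suc (suc m)} ≈ id
  -- `reverse` sends `0` to the last position, which is a `suc` because `n ≥ 2`.
  reverse≉id rev≈id with () ← rev≈id zero
proposition2p7 (suc zero) (s≤s ())
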